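{- Let $q=p$ be an odd prime, and let $P(X,Z)\in\mathbb{F}_q[X,Z]$ be monic in $Z$ with $\deg_Z P\ge 2$. Suppose that $P(0,Z)$ has exactly $r$ distinct roots in $\mathbb{F}_q$. Let $$Q(X,Y,Z)=XQ_1(X,Y,Z)+Y^2+b(Z)Y+c(Z),$$ where $Q_1(X,Y,Z)\in\mathbb{F}_q[X,Y,Z]$, $b(Z),c(Z)\in\mathbb{F}_q[Z]$, and $\deg_Y Q_1<2$. For each $\gamma\in\mathbb{F}_q$ set $D(\gamma)=c(\gamma)-\frac{b(\gamma)^2}{4}$, and let $$N_0'=\#\{(\beta,\gamma)\in\mathbb{F}_q^2\mid P(0,\gamma)=0,\ Q(0,\beta,\gamma)=0\}.$$ Then $$N_0'=r+\eta(-1)\sum_{\substack{\gamma\in\mathbb{F}_q\\ P(0,\gamma)=0}}\eta(D(\gamma)).$$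
   Context: $\eta$ is the quadratic character of $\mathbb{F}_q$ ($q$ odd): $\eta(a)=1$ if $a$ is a nonzero square, $\eta(a)=-1$ if $a$ is a nonsquare, and $\eta(0)=0$. "Monic in $Z$" means leading coefficient $1$ as a polynomial in $Z$ over the polynomial ring in the other variables. -}

module Defs where

open import Level using (Level; 0ℓ)
open import Algebra.Bundles.Raw using (RawRing)
open import Data.Nat as ℕ using (ℕ; NonZero)
open import Data.Nat.DivMod using (_mod_)
open import Data.Integer as ℤ using (ℤ; 0ℤ; 1ℤ; -1ℤ)
open import Data.Fin using (Fin; toℕ)
open import Data.Fin.Properties using (_≟_; any?)
open import Data.List using (List; []; _∷_; map; foldr; filter; allFin)
open import Data.Product using (∃; _×_; _,_)
open import Relation.Binary.PropositionalEquality using (_≡_)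
open import Relation.Nullary using (yes; no)

sumℤ : List ℤ → ℤ
sumℤ = foldr ℤ._+_ 0ℤ

-- Univariate polynomials over R as coefficient lists, constant term first.
-- Trailing zeros are allowed, so equality of polynomials is _≈ₚ_, not _≡_.
module Poly {c ℓ : Level} (R : RawRing c ℓ) where
  open RawRing R

  coeff : List Carrier → ℕ → Carrier
  coeff []      _          = 0#
  coeff (a ∷ f) ℕ.zero    = a
  coeff (a ∷ f) (ℕ.suc n) = coeff f n

  _≈ₚ_ : List Carrier → List Carrier → Set ℓ
  f ≈ₚ g = ∀ n → coeff f n ≈ coeff g n

  _+ₚ_ : List Carrier → List Carrier → List Carrier
  []      +ₚ g       = g
  (a ∷ f) +ₚ []      = a ∷ f
  (a ∷ f) +ₚ (b ∷ g) = (a + b) ∷ (f +ₚ g)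

  _*ₚ_ : List Carrier → List Carrier → List Carrier
  []      *ₚ g = []
  (a ∷ f) *ₚ g = map (a *_) g +ₚ (0# ∷ (f *ₚ g))

  polyRing : RawRing c ℓ
  polyRing = record
    { Carrier = List Carrier
    ; _≈_     = _≈ₚ_
    ; _+_     = _+ₚ_
    ; _*_     = _*ₚ_
    ; -_      = map (-_)
    ; 0#      = []
    ; 1#      = 1# ∷ []
    }

  const : Carrier → List Carrier
  const a = a ∷ []

  var : List Carrier
  var = 0# ∷ 1# ∷ []

  Monic : List Carrier → Set ℓ
  Monic f = ∃ λ d → coeff f d ≈ 1# × (∀ n → d ℕ.< n → coeff f n ≈ 0#)

  -- deg f ≥ k and deg f < k; the zero polynomial has degree −∞.
  Deg≥ : ℕ → List Carrier → Set ℓ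
  Deg≥ k f = ∃ λ n → k ℕ.≤ n × coeff f n ≉ 0#

  Deg< : ℕ → List Carrier → Set ℓ
  Deg< k f = ∀ n → k ℕ.≤ n → coeff f n ≈ 0#

-- Σ φ(aᵢ) sⁱ, where φ maps the coefficients into R.
eval₂ : ∀ {a c ℓ} {A : Set a} (R : RawRing c ℓ) →
        (A → RawRing.Carrier R) → List A → RawRing.Carrier R → RawRing.Carrier R
eval₂ R φ f s = foldr (λ a acc → φ a + s * acc) 0# f
  where open RawRing R

-- The field 𝔽 = 𝔽ₚ (for p prime) of residues mod p, with _≡_ as its equality.
module PrimeField (p : ℕ) .{{_ : NonZero p}} where

  𝔽 : Set
  𝔽 = Fin p

  fromℕ : ℕ → 𝔽
  fromℕ n = n mod p

  𝔽-ring : RawRing 0ℓ 0ℓ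
  𝔽-ring = record
    { Carrier = 𝔽
    ; _≈_     = _≡_
    ; _+_     = λ a b → fromℕ (toℕ a ℕ.+ toℕ b)
    ; _*_     = λ a b → fromℕ (toℕ a ℕ.* toℕ b)
    ; -_      = λ a → fromℕ (p ℕ.∸ toℕ a)
    ; 0#      = fromℕ 0
    ; 1#      = fromℕ 1
    }

  open RawRing 𝔽-ring public using (_+_; _*_; -_; 0#; 1#)

  infixl 6 _-_
  infixl 7 _/_
  infix 8 _⁻¹

  _-_ : 𝔽 → 𝔽 → 𝔽
  a - b = a + (- b)

  -- 0 has no inverse; 0 ⁻¹ = 0 by convention.
  _⁻¹ : 𝔽 → 𝔽
  a ⁻¹ with any? (λ b → a * b ≟ 1#)
  ... | yes (b , _) = b
  ... | no  _       = 0#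

  _/_ : 𝔽 → 𝔽 → 𝔽
  a / b = a * b ⁻¹

  η : 𝔽 → ℤ
  η a with a ≟ 0# | any? (λ b → b * b ≟ a)
  ... | yes _ | _     = 0ℤ
  ... | no  _ | yes _ = 1ℤ
  ... | no  _ | no  _ = -1ℤ

  -- 𝔽[X,Z] is 𝔽[X][Z], and 𝔽[X,Y,Z] is 𝔽[X,Z][Y]: the outermost variable is the
  -- one in which degrees are taken.  𝔽[X] and 𝔽[Z] are both copies of 𝔽[T].
  𝔽[T]-ring 𝔽[X,Z]-ring 𝔽[X,Y,Z]-ring : RawRing 0ℓ 0ℓ
  𝔽[T]-ring     = Poly.polyRing 𝔽-ring
  𝔽[X,Z]-ring   = Poly.polyRing 𝔽[T]-ring
  𝔽[X,Y,Z]-ring = Poly.polyRing 𝔽[X,Z]-ring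

  𝔽[X] 𝔽[Z] 𝔽[X,Z] 𝔽[X,Y,Z] : Set
  𝔽[X]     = RawRing.Carrier 𝔽[T]-ring
  𝔽[Z]     = RawRing.Carrier 𝔽[T]-ring
  𝔽[X,Z]   = RawRing.Carrier 𝔽[X,Z]-ring
  𝔽[X,Y,Z] = RawRing.Carrier 𝔽[X,Y,Z]-ring

  eval : List 𝔽 → 𝔽 → 𝔽
  eval = eval₂ 𝔽-ring (λ a → a)

  evalXZ : 𝔽[X,Z] → 𝔽 → 𝔽 → 𝔽
  evalXZ f x z = eval₂ 𝔽-ring (λ a → eval a x) f z

  evalXYZ : 𝔽[X,Y,Z] → 𝔽 → 𝔽 → 𝔽 → 𝔽
  evalXYZ f x y z = eval₂ 𝔽-ring (λ a → evalXZ a x z) f y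

  -- f(X,Z) ↦ f(x,Z)
  specialiseX : 𝔽 → 𝔽[X,Z] → 𝔽[Z]
  specialiseX x = map (λ a → eval a x)

  -- The distinct roots in 𝔽: each element of 𝔽 occurs once in allFin p.
  roots : 𝔽[Z] → List 𝔽
  roots f = filter (λ γ → eval f γ ≟ 0#) (allFin p)

  MonicZ : 𝔽[X,Z] → Set
  MonicZ = Poly.Monic 𝔽[T]-ring

  DegZ≥ : ℕ → 𝔽[X,Z] → Set
  DegZ≥ = Poly.Deg≥ 𝔽[T]-ring

  DegY< : ℕ → 𝔽[X,Y,Z] → Set
  DegY< = Poly.Deg< 𝔽[X,Z]-ring

  X Y : 𝔽[X,Y,Z]
  X = Poly.const 𝔽[X,Z]-ring (Poly.const 𝔽[T]-ring (Poly.var 𝔽-ring))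
  Y = Poly.var 𝔽[X,Z]-ring

  inZ : 𝔽[Z] → 𝔽[X,Y,Z]
  inZ f = Poly.const 𝔽[X,Z]-ring (map (Poly.const 𝔽-ring) f)

  infixl 6 _⊕_
  infixl 7 _⊗_

  _⊕_ _⊗_ : 𝔽[X,Y,Z] → 𝔽[X,Y,Z] → 𝔽[X,Y,Z]
  _⊕_ = RawRing._+_ 𝔽[X,Y,Z]-ring
  _⊗_ = RawRing._*_ 𝔽[X,Y,Z]-ring

{-# OPTIONS --safe #-}
-- At x = 0 the term X Q₁ vanishes, and with h = b(γ)/2 the equation Q(0,β,γ) = 0
-- reads (β + h)² = − D(γ).  It has 1 + η(− D(γ)) solutions β, and
-- η(− D) = η(− 1) η(D); it remains to sum over the roots γ of P(0,Z).
module Submission where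

open import Defs
open import Level using (Level; 0ℓ)
open import Algebra.Bundles using (CommutativeRing)
open import Algebra.Bundles.Raw using (RawRing)
open import Data.Nat as ℕ using (ℕ; NonZero)
open import Data.Nat.Divisibility using (_∣_; divides; m%n≡0⇒n∣m; n∣m⇒m%n≡0)
open import Data.Nat.DivMod using (_%_; m%n<n; m<n⇒m%n≡m; %-distribˡ-+; %-distribˡ-*)
open import Data.Nat.Primality using (Prime; euclidsLemma; ¬prime[1]; irreducible[2])
import Data.Nat.ListAction as List
import Data.Nat.Properties as ℕ
open import Data.Integer as ℤ using (ℤ; +_; 0ℤ; 1ℤ; -1ℤ)
import Data.Integer.Properties as ℤ
import Data.Integer.Solver as ℤSolver
open import Data.Fin using (Fin; toℕ; punchOut)
open import Data.Fin.Properties using (_≟_; any?; toℕ<n; toℕ-injective; toℕ-fromℕ<; fromℕ<-cong; punchOut-injective; injective⇒≤)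
open import Data.List using (List; []; _∷_; [_]; _++_; length; map; filter; allFin; cartesianProduct)
open import Data.List.Properties using (filter-++; filter-≐; filter-none; length-++; map-cong)
open import Data.List.Membership.Propositional using (_∈_)
open import Data.List.Membership.Propositional.Properties using (∈-filter⁺; ∈-filter⁻; ∈-allFin)
open import Data.List.Membership.Propositional.Properties.WithK using (unique∧set⇒bag)
open import Data.List.Relation.Binary.BagAndSetEquality using (∼bag⇒↭)
open import Data.List.Relation.Binary.Permutation.Propositional.Properties using (↭-length)
import Data.List.Relation.Unary.All as All
open import Data.List.Relation.Unary.AllPairs using ([]; _∷_)
open import Data.List.Relation.Unary.Any using (here; there)
open import Data.List.Relation.Unary.Unique.Propositional using (Unique)
open import Data.List.Relation.Unary.Unique.Propositional.Properties using (allFin⁺; filter⁺)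
open import Data.Product using (∃; _×_; _,_; proj₁; proj₂)
open import Data.Sum using (_⊎_; inj₁; inj₂; [_,_]′; reduce)
open import Function using (_∘_; _⇔_; mk⇔; Equivalence)
open import Function.Definitions using (Injective)
open import Relation.Binary.PropositionalEquality using (_≡_; _≢_; refl; sym; trans; cong; cong₂; isEquivalence; module ≡-Reasoning)
open import Relation.Nullary using (¬_; yes; no; contradiction; _×-dec_)
open import Relation.Unary using (Pred; Decidable)

private
  variable
    a c ℓ ℓ₁ : Level

-- Identities in commutative rings.

module CommutativeRingProperties (R : CommutativeRing c ℓ) where
  open CommutativeRing R renaming (refl to ≈-refl; sym to ≈-sym; trans to ≈-trans)
  open import Algebra.Properties.Ring ring
  open import Algebra.Solver.Ring.NaturalCoefficients.Default commutativeSemiring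
  open import Relation.Binary.Reasoning.Setoid setoid

  -- Abstract, since with-abstraction would otherwise normalise the solver's proof terms.
  abstract
    [x-y][x+y]≈0 : ∀ x y → x * x ≈ y * y → (x - y) * (x + y) ≈ 0#
    [x-y][x+y]≈0 x y x²≈y² = begin
      -- The solver knows only semirings, so `- y` enters as a free variable `n`. The cancellation
      -- of `y - y` is left to the next line.
      (x - y) * (x + y)                   ≈⟨ solve 3 (λ x y n → (x :+ n) :* (x :+ y) := x :* x :+ n :* y :+ x :* (y :+ n)) ≈-refl x y (- y) ⟩
      x * x + - y * y + x * (y - y)       ≈⟨ +-cong (+-cong x²≈y² (≈-sym (-‿distribˡ-* y y))) (≈-trans (*-congˡ (-‿inverseʳ y)) (zeroʳ x)) ⟩
      y * y + - (y * y) + 0#              ≈⟨ ≈-trans (+-identityʳ _) (-‿inverseʳ _) ⟩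
      0#                                  ∎

    -x*-x≈x*x : ∀ x → - x * - x ≈ x * x
    -x*-x≈x*x x = begin
      - x * - x     ≈⟨ -‿distribˡ-* x (- x) ⟨
      - (x * - x)   ≈⟨ -‿cong (-‿distribʳ-* x x) ⟨
      - - (x * x)   ≈⟨ -‿involutive (x * x) ⟩
      x * x         ∎

    xy*xy≈xx*yy : ∀ x y → (x * y) * (x * y) ≈ (x * x) * (y * y)
    xy*xy≈xx*yy = solve 2 (λ x y → (x :* y) :* (x :* y) := (x :* x) :* (y :* y)) ≈-refl

    complete-square : ∀ x h k → x * x + (h + h) * x + k ≈ (x + h) * (x + h) + (k - h * h)
    complete-square x h k = begin
      x * x + (h + h) * x + k                     ≈⟨ +-identityʳ _ ⟨
      -- The zero is expanded so that the next regrouping is a semiring identity, with `n` standing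
      -- for `- (h * h)`.
      x * x + (h + h) * x + k + 0#                ≈⟨ +-congˡ (-‿inverseʳ (h * h)) ⟨
      x * x + (h + h) * x + k + (h * h - h * h)   ≈⟨ solve 4 (λ x h k n → x :* x :+ (h :+ h) :* x :+ k :+ (h :* h :+ n) := (x :+ h) :* (x :+ h) :+ (k :+ n)) ≈-refl x h k (- (h * h)) ⟩
      (x + h) * (x + h) + (k - h * h)             ∎

-- Evaluation of polynomials as a homomorphism.

-- The source is a raw ring, so that rings of coefficient lists qualify without a proof of their
-- ring laws. All the algebra takes place in the target `R`.
record PreservesOps (A : RawRing a ℓ₁) (R : CommutativeRing c ℓ)
                    (φ : RawRing.Carrier A → CommutativeRing.Carrier R) : Set (a Level.⊔ ℓ) where
  private
    module A = RawRing A
  open CommutativeRing R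
  field
    0#-homo : φ A.0# ≈ 0#
    +-homo  : ∀ x y → φ (x A.+ y) ≈ φ x + φ y
    *-homo  : ∀ x y → φ (x A.* y) ≈ φ x * φ y

module _ {A : RawRing a ℓ₁} {R : CommutativeRing c ℓ}
         {φ : RawRing.Carrier A → CommutativeRing.Carrier R}
         (φ-homo : PreservesOps A R φ) (s : CommutativeRing.Carrier R) where
  private
    module A = RawRing A
  open CommutativeRing R renaming (refl to ≈-refl; sym to ≈-sym; trans to ≈-trans)
  open PreservesOps φ-homo
  open Poly A using (_+ₚ_; _*ₚ_; polyRing)
  open import Algebra.Solver.Ring.NaturalCoefficients.Default commutativeSemiring
  open import Relation.Binary.Reasoning.Setoid setoid

  private
    ev : List A.Carrier → Carrier
    ev f = eval₂ rawRing φ f s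

  eval₂-+ : ∀ f g → ev (f +ₚ g) ≈ ev f + ev g
  eval₂-+ []      g       = ≈-sym (+-identityˡ (ev g))
  eval₂-+ (x ∷ f) []      = ≈-sym (+-identityʳ (ev (x ∷ f)))
  eval₂-+ (x ∷ f) (y ∷ g) = begin
    φ (x A.+ y) + s * ev (f +ₚ g)          ≈⟨ +-cong (+-homo x y) (*-congˡ (eval₂-+ f g)) ⟩
    (φ x + φ y) + s * (ev f + ev g)        ≈⟨ solve 5 (λ x y s f g → (x :+ y) :+ s :* (f :+ g) := (x :+ s :* f) :+ (y :+ s :* g)) ≈-refl (φ x) (φ y) s (ev f) (ev g) ⟩
    (φ x + s * ev f) + (φ y + s * ev g)    ∎

  eval₂-scale : ∀ x g → ev (map (x A.*_) g) ≈ φ x * ev g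
  eval₂-scale x []      = ≈-sym (zeroʳ (φ x))
  eval₂-scale x (y ∷ g) = begin
    φ (x A.* y) + s * ev (map (x A.*_) g)   ≈⟨ +-cong (*-homo x y) (*-congˡ (eval₂-scale x g)) ⟩
    φ x * φ y + s * (φ x * ev g)            ≈⟨ solve 4 (λ x y s g → x :* y :+ s :* (x :* g) := x :* (y :+ s :* g)) ≈-refl (φ x) (φ y) s (ev g) ⟩
    φ x * (φ y + s * ev g)                  ∎

  eval₂-* : ∀ f g → ev (f *ₚ g) ≈ ev f * ev g
  eval₂-* []      g = ≈-sym (zeroˡ (ev g))
  eval₂-* (x ∷ f) g = begin
    ev (map (x A.*_) g +ₚ (A.0# ∷ (f *ₚ g)))             ≈⟨ eval₂-+ (map (x A.*_) g) (A.0# ∷ (f *ₚ g)) ⟩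
    ev (map (x A.*_) g) + (φ A.0# + s * ev (f *ₚ g))     ≈⟨ +-cong (eval₂-scale x g) (+-cong 0#-homo (*-congˡ (eval₂-* f g))) ⟩
    φ x * ev g + (0# + s * (ev f * ev g))                ≈⟨ solve 4 (λ x s f g → x :* g :+ (con 0 :+ s :* (f :* g)) := (x :+ s :* f) :* g) ≈-refl (φ x) s (ev f) (ev g) ⟩
    (φ x + s * ev f) * ev g                              ∎

  -- The conclusion has the same form as the assumption on `φ`, so it can be iterated, adjoining one
  -- variable at a time.
  eval₂-homo : PreservesOps polyRing R ev
  eval₂-homo = record { 0#-homo = ≈-refl ; +-homo = eval₂-+ ; *-homo = eval₂-* }

-- Counting in finite sets and lists.

private
  variable
    A B : Set a

-- Pigeonhole: if `y` were missed, punching it out of the codomain would give an injection into a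
-- set with one element fewer.
injective⇒surjective : ∀ {n} {f : Fin n → Fin n} → Injective _≡_ _≡_ f → ∀ y → ∃ λ x → f x ≡ y
injective⇒surjective {ℕ.suc n} {f} f-injective y with any? (λ x → f x ≟ y)
... | yes x∈f⁻¹y = x∈f⁻¹y
... | no  y∉f    = contradiction (injective⇒≤ punched-injective) (ℕ.<⇒≱ ℕ.≤-refl)
  where
  y≢f : ∀ x → y ≢ f x
  y≢f x y≡fx = y∉f (x , sym y≡fx)

  punched-injective : Injective _≡_ _≡_ (λ x → punchOut (y≢f x))
  punched-injective {x} {x′} eq = f-injective (punchOut-injective (y≢f x) (y≢f x′) eq)

-- Two duplicate-free lists with the same members are permutations of each other. This reduces
-- counting solutions to listing them.
length-filter-allFin : ∀ {n} {P : Pred (Fin n) ℓ} (P? : Decidable P) {xs} → Unique xs →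
                       (∀ x → P x ⇔ x ∈ xs) → length (filter P? (allFin n)) ≡ length xs
length-filter-allFin {n = n} P? xs! P⇔∈xs =
  ↭-length (∼bag⇒↭ (unique∧set⇒bag (filter⁺ P? (allFin⁺ n)) xs! (λ {x} →
    mk⇔ (Equivalence.to (P⇔∈xs x) ∘ proj₂ ∘ ∈-filter⁻ P? {xs = allFin n})
        (λ x∈xs → ∈-filter⁺ P? (∈-allFin x) (Equivalence.from (P⇔∈xs x) x∈xs)))))

sum-map-+ : ∀ (f g : A → ℕ) xs →
            List.sum (map (λ x → f x ℕ.+ g x) xs) ≡ List.sum (map f xs) ℕ.+ List.sum (map g xs)
sum-map-+ f g []       = refl
sum-map-+ f g (x ∷ xs) = begin
  f x ℕ.+ g x ℕ.+ List.sum (map (λ x → f x ℕ.+ g x) xs)     ≡⟨ cong (f x ℕ.+ g x ℕ.+_) (sum-map-+ f g xs) ⟩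
  f x ℕ.+ g x ℕ.+ (List.sum (map f xs) ℕ.+ List.sum (map g xs))
    ≡⟨ interchange (f x) (g x) _ _ ⟩
  f x ℕ.+ List.sum (map f xs) ℕ.+ (g x ℕ.+ List.sum (map g xs)) ∎
  where
  open ≡-Reasoning
  open import Algebra.Properties.CommutativeSemigroup ℕ.+-commutativeSemigroup using (interchange)

module _ {P : Pred (A × B) ℓ} (P? : Decidable P) where

  private
    count : List A → B → ℕ
    count xs y = length (filter (λ x → P? (x , y)) xs)

  -- `count [ x ] y` is the indicator of `P (x , y)`, written as a count so that it can be added to
  -- `count xs y`.
  length-filter-pairs : ∀ x ys → length (filter P? (map (x ,_) ys)) ≡ List.sum (map (count [ x ]) ys)
  length-filter-pairs x []       = refl
  length-filter-pairs x (y ∷ ys) with P? (x , y)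
  ... | yes _ = cong ℕ.suc (length-filter-pairs x ys)
  ... | no  _ = length-filter-pairs x ys

  -- Double counting: the product is enumerated by first coordinate, but the fibres whose size is
  -- known lie over the second. Each new `x` adds its indicator to every fibre.
  length-filter-cartesianProduct : ∀ xs ys →
    length (filter P? (cartesianProduct xs ys)) ≡ List.sum (map (count xs) ys)
  length-filter-cartesianProduct []       ys = sum-zeros ys
    where
    sum-zeros : ∀ ys → 0 ≡ List.sum (map (λ _ → 0) ys)
    sum-zeros []       = refl
    sum-zeros (_ ∷ ys) = sum-zeros ys
  length-filter-cartesianProduct (x ∷ xs) ys = begin
    length (filter P? (map (x ,_) ys ++ cartesianProduct xs ys))
      ≡⟨ cong length (filter-++ P? (map (x ,_) ys) _) ⟩
    length (filter P? (map (x ,_) ys) ++ filter P? (cartesianProduct xs ys))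
      ≡⟨ length-++ (filter P? (map (x ,_) ys)) ⟩
    length (filter P? (map (x ,_) ys)) ℕ.+ length (filter P? (cartesianProduct xs ys))
      ≡⟨ cong₂ ℕ._+_ (length-filter-pairs x ys) (length-filter-cartesianProduct xs ys) ⟩
    List.sum (map (count [ x ]) ys) ℕ.+ List.sum (map (count xs) ys)
      ≡⟨ sum-map-+ (count [ x ]) (count xs) ys ⟨
    List.sum (map (λ y → count [ x ] y ℕ.+ count xs y) ys)
      ≡⟨ cong List.sum (map-cong count-∷ ys) ⟨
    List.sum (map (count (x ∷ xs)) ys) ∎
    where
    open ≡-Reasoning

    count-∷ : ∀ y → count (x ∷ xs) y ≡ count [ x ] y ℕ.+ count xs y
    count-∷ y with P? (x , y)
    ... | yes _ = refl
    ... | no  _ = refl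

module _ {P : Pred B ℓ} (P? : Decidable P) (w : B → ℤ) (e : ℤ) (N : B → ℕ)
         (N-yes : ∀ y → P y → + N y ≡ 1ℤ ℤ.+ e ℤ.* w y) (N-no : ∀ y → ¬ P y → N y ≡ 0) where

  -- An entry outside `P` adds nothing to either side. An entry in `P` adds 1 through the length and
  -- `e ℤ.* w y` through the sum.
  sum-over-filter : ∀ ys →
    + List.sum (map N ys) ≡ + length (filter P? ys) ℤ.+ e ℤ.* sumℤ (map w (filter P? ys))
  sum-over-filter []       = sym (trans (ℤ.+-identityˡ _) (ℤ.*-zeroʳ e))
  sum-over-filter (y ∷ ys) with P? y
  ... | no  ¬Py rewrite N-no y ¬Py = sum-over-filter ys
  ... | yes Py  = begin
    + (N y ℕ.+ List.sum (map N ys))                ≡⟨ ℤ.pos-+ (N y) _ ⟩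
    + N y ℤ.+ + List.sum (map N ys)                ≡⟨ cong₂ ℤ._+_ (N-yes y Py) (sum-over-filter ys) ⟩
    1ℤ ℤ.+ e ℤ.* w y ℤ.+ (+ k ℤ.+ e ℤ.* S)         ≡⟨ rearrange (w y) (+ k) S ⟩
    1ℤ ℤ.+ + k ℤ.+ e ℤ.* (w y ℤ.+ S)               ∎
    where
    open ≡-Reasoning
    open ℤSolver.+-*-Solver
    k = length (filter P? ys)
    S = sumℤ (map w (filter P? ys))

    rearrange : ∀ u k S → 1ℤ ℤ.+ e ℤ.* u ℤ.+ (k ℤ.+ e ℤ.* S) ≡ 1ℤ ℤ.+ k ℤ.+ e ℤ.* (u ℤ.+ S)
    rearrange = solve 4 (λ e u k S → con 1ℤ :+ e :* u :+ (k :+ e :* S) := con 1ℤ :+ k :+ e :* (u :+ S)) refl e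

-- The commutative ring of residues modulo `p`.

module PrimeFieldProperties (p : ℕ) .{{_ : NonZero p}} where
  open PrimeField p

  fromℕ-cong-% : ∀ {m n} → m % p ≡ n % p → fromℕ m ≡ fromℕ n
  fromℕ-cong-% {m} {n} eq = fromℕ<-cong (m % p) (n % p) eq (m%n<n m p) (m%n<n n p)

  toℕ-fromℕ : ∀ n → toℕ (fromℕ n) ≡ n % p
  toℕ-fromℕ n = toℕ-fromℕ< (m%n<n n p)

  fromℕ-toℕ : ∀ x → fromℕ (toℕ x) ≡ x
  fromℕ-toℕ x = toℕ-injective (trans (toℕ-fromℕ (toℕ x)) (m<n⇒m%n≡m (toℕ<n x)))

  fromℕ-+ : ∀ m n → fromℕ (m ℕ.+ n) ≡ fromℕ m + fromℕ n
  fromℕ-+ m n = trans (fromℕ-cong-% (%-distribˡ-+ m n p))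
                      (sym (cong₂ (λ i j → fromℕ (i ℕ.+ j)) (toℕ-fromℕ m) (toℕ-fromℕ n)))

  fromℕ-* : ∀ m n → fromℕ (m ℕ.* n) ≡ fromℕ m * fromℕ n
  fromℕ-* m n = trans (fromℕ-cong-% (%-distribˡ-* m n p))
                      (sym (cong₂ (λ i j → fromℕ (i ℕ.* j)) (toℕ-fromℕ m) (toℕ-fromℕ n)))

  -- Reduction modulo `p` can be postponed: an inner `fromℕ` is absorbed by the outer one. The ring
  -- laws below thus follow from those of ℕ under a single `fromℕ`.
  fromℕ-+ˡ : ∀ m x → fromℕ m + x ≡ fromℕ (m ℕ.+ toℕ x)
  fromℕ-+ˡ m x = sym (trans (fromℕ-+ m (toℕ x)) (cong (λ y → fromℕ m + y) (fromℕ-toℕ x)))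

  fromℕ-+ʳ : ∀ x n → x + fromℕ n ≡ fromℕ (toℕ x ℕ.+ n)
  fromℕ-+ʳ x n = sym (trans (fromℕ-+ (toℕ x) n) (cong (_+ fromℕ n) (fromℕ-toℕ x)))

  fromℕ-*ˡ : ∀ m x → fromℕ m * x ≡ fromℕ (m ℕ.* toℕ x)
  fromℕ-*ˡ m x = sym (trans (fromℕ-* m (toℕ x)) (cong (λ y → fromℕ m * y) (fromℕ-toℕ x)))

  fromℕ-*ʳ : ∀ x n → x * fromℕ n ≡ fromℕ (toℕ x ℕ.* n)
  fromℕ-*ʳ x n = sym (trans (fromℕ-* (toℕ x) n) (cong (_* fromℕ n) (fromℕ-toℕ x)))

  fromℕ≡0⇒∣ : ∀ {n} → fromℕ n ≡ 0# → p ∣ n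
  fromℕ≡0⇒∣ {n} eq = m%n≡0⇒n∣m n p
    -- `toℕ 0#` equals `0 % p`, which does not compute for a variable `p`. It is zero because `p`
    -- divides 0.
    (trans (sym (toℕ-fromℕ n)) (trans (cong toℕ eq) (trans (toℕ-fromℕ 0) (n∣m⇒m%n≡0 0 p (divides 0 refl)))))

  ∣⇒fromℕ≡0 : ∀ {n} → p ∣ n → fromℕ n ≡ 0#
  ∣⇒fromℕ≡0 {n} p∣n = fromℕ-cong-% (trans (n∣m⇒m%n≡0 n p p∣n) (sym (n∣m⇒m%n≡0 0 p (divides 0 refl))))

  +-comm : ∀ x y → x + y ≡ y + x
  +-comm x y = cong fromℕ (ℕ.+-comm (toℕ x) (toℕ y))

  *-comm : ∀ x y → x * y ≡ y * x
  *-comm x y = cong fromℕ (ℕ.*-comm (toℕ x) (toℕ y))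

  +-assoc : ∀ x y z → (x + y) + z ≡ x + (y + z)
  +-assoc x y z = trans (fromℕ-+ˡ (toℕ x ℕ.+ toℕ y) z)
    (trans (cong fromℕ (ℕ.+-assoc (toℕ x) (toℕ y) (toℕ z))) (sym (fromℕ-+ʳ x (toℕ y ℕ.+ toℕ z))))

  *-assoc : ∀ x y z → (x * y) * z ≡ x * (y * z)
  *-assoc x y z = trans (fromℕ-*ˡ (toℕ x ℕ.* toℕ y) z)
    (trans (cong fromℕ (ℕ.*-assoc (toℕ x) (toℕ y) (toℕ z))) (sym (fromℕ-*ʳ x (toℕ y ℕ.* toℕ z))))

  +-identityˡ : ∀ x → 0# + x ≡ x
  +-identityˡ x = trans (fromℕ-+ˡ 0 x) (fromℕ-toℕ x)

  *-identityˡ : ∀ x → 1# * x ≡ x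
  *-identityˡ x = trans (fromℕ-*ˡ 1 x) (trans (cong fromℕ (ℕ.*-identityˡ (toℕ x))) (fromℕ-toℕ x))

  *-distribˡ-+ : ∀ x y z → x * (y + z) ≡ x * y + x * z
  *-distribˡ-+ x y z = trans (fromℕ-*ʳ x (toℕ y ℕ.+ toℕ z))
    (trans (cong fromℕ (ℕ.*-distribˡ-+ (toℕ x) (toℕ y) (toℕ z))) (fromℕ-+ (toℕ x ℕ.* toℕ y) (toℕ x ℕ.* toℕ z)))

  -‿inverseˡ : ∀ x → - x + x ≡ 0#
  -‿inverseˡ x = trans (fromℕ-+ˡ (p ℕ.∸ toℕ x) x)
    (∣⇒fromℕ≡0 (divides 1 (trans (ℕ.m∸n+n≡m (ℕ.<⇒≤ (toℕ<n x))) (sym (ℕ.*-identityˡ p)))))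

  commutativeRing : CommutativeRing 0ℓ 0ℓ
  commutativeRing = record
    { Carrier = 𝔽
    ; _≈_ = _≡_
    ; _+_ = _+_
    ; _*_ = _*_
    ; -_ = λ x → - x
    ; 0# = 0#
    ; 1# = 1#
    ; isCommutativeRing = record
      { isRing = record
        { +-isAbelianGroup = record
          { isGroup = record
            { isMonoid = record
              { isSemigroup = record
                { isMagma = record { isEquivalence = isEquivalence ; ∙-cong = cong₂ _+_ }
                ; assoc = +-assoc
                }
              ; identity = comm∧idˡ⇒id +-comm +-identityˡ
              }
            ; inverse = comm∧invˡ⇒inv +-comm -‿inverseˡ
            ; ⁻¹-cong = cong (λ x → - x)
            }
          ; comm = +-comm
          }
        ; *-cong = cong₂ _*_
        ; *-assoc = *-assoc
        ; *-identity = comm∧idˡ⇒id *-comm *-identityˡ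
        ; distrib = *-distribˡ-+ , comm∧distrˡ⇒distrʳ *-comm *-distribˡ-+
        }
      ; *-comm = *-comm
      }
    }
    where open import Algebra.Consequences.Propositional using (comm∧idˡ⇒id; comm∧invˡ⇒inv; comm∧distrˡ⇒distrʳ)

  open CommutativeRing commutativeRing public
    using (ring; +-identityʳ; *-identityʳ; zeroˡ; zeroʳ; -‿inverseʳ; distribʳ)
  open import Algebra.Properties.Ring ring public
    using (-‿involutive; -‿injective; -0#≈0#; -‿distribˡ-*; +-inverseˡ-unique; -1*x≈-x; x[y-z]≈xy-xz; x∙y⁻¹≈ε⇒x≈y; x≈y⇒x∙y⁻¹≈ε)
  open CommutativeRingProperties commutativeRing public

-- Field arithmetic for an odd prime.

module OddPrimeFieldProperties (p : ℕ) .{{_ : NonZero p}} (p-prime : Prime p) (p-odd : ¬ (2 ∣ p)) where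
  open PrimeField p
  open PrimeFieldProperties p
  open ≡-Reasoning

  -- If the product vanishes, `p` divides the product of the representatives, and Euclid's lemma
  -- applies.
  x*y≡0⇒x≡0∨y≡0 : ∀ x y → x * y ≡ 0# → x ≡ 0# ⊎ y ≡ 0#
  x*y≡0⇒x≡0∨y≡0 x y xy≡0 with euclidsLemma (toℕ x) (toℕ y) p-prime (fromℕ≡0⇒∣ xy≡0)
  ... | inj₁ p∣x = inj₁ (trans (sym (fromℕ-toℕ x)) (∣⇒fromℕ≡0 p∣x))
  ... | inj₂ p∣y = inj₂ (trans (sym (fromℕ-toℕ y)) (∣⇒fromℕ≡0 p∣y))

  x*x≡0⇒x≡0 : ∀ {x} → x * x ≡ 0# → x ≡ 0#
  x*x≡0⇒x≡0 {x} = reduce ∘ x*y≡0⇒x≡0∨y≡0 x x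

  x+y≡0⇒x≡-y : ∀ {x y} → x + y ≡ 0# → x ≡ - y
  x+y≡0⇒x≡-y {x} {y} = +-inverseˡ-unique x y

  x-y≡0⇒x≡y : ∀ {x y} → x - y ≡ 0# → x ≡ y
  x-y≡0⇒x≡y {x} {y} = x∙y⁻¹≈ε⇒x≈y x y

  x*x≡y*y⇒x≡±y : ∀ {x y} → x * x ≡ y * y → x ≡ y ⊎ x ≡ - y
  x*x≡y*y⇒x≡±y {x} {y} eq with x*y≡0⇒x≡0∨y≡0 (x - y) (x + y) ([x-y][x+y]≈0 x y eq)
  ... | inj₁ x-y≡0 = inj₁ (x-y≡0⇒x≡y x-y≡0)
  ... | inj₂ x+y≡0 = inj₂ (x+y≡0⇒x≡-y x+y≡0)

  -x≡0⇒x≡0 : ∀ {x} → - x ≡ 0# → x ≡ 0#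
  -x≡0⇒x≡0 -x≡0 = -‿injective (trans -x≡0 (sym -0#≈0#))

  *-cancelˡ-nonZero : ∀ {x} → x ≢ 0# → Injective _≡_ _≡_ (x *_)
  *-cancelˡ-nonZero {x} x≢0 {y} {z} xy≡xz
    with x*y≡0⇒x≡0∨y≡0 x (y - z) (trans (x[y-z]≈xy-xz x y z) (x≈y⇒x∙y⁻¹≈ε xy≡xz))
  ... | inj₁ x≡0   = contradiction x≡0 x≢0
  ... | inj₂ y-z≡0 = x-y≡0⇒x≡y y-z≡0

  -- Multiplication by a nonzero `x` is injective on a finite set, hence onto, hence attains `1#`.
  -- The search in `_⁻¹` therefore never reaches its default value.
  *-inverseʳ : ∀ {x} → x ≢ 0# → x * x ⁻¹ ≡ 1#
  *-inverseʳ {x} x≢0 with any? (λ y → x * y ≟ 1#)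
  ... | yes (_ , xy≡1) = xy≡1
  ... | no  ∄y         = contradiction (injective⇒surjective (*-cancelˡ-nonZero x≢0) 1#) ∄y

  -- Otherwise `p` divides 2, so it is 1, which is not prime, or 2, which is not odd.
  2≢0 : fromℕ 2 ≢ 0#
  2≢0 2≡0 with irreducible[2] (fromℕ≡0⇒∣ 2≡0)
  ... | inj₁ refl = ¬prime[1] p-prime
  ... | inj₂ refl = p-odd (divides 1 refl)

  1≢0 : 1# ≢ 0#
  1≢0 1≡0 = 2≢0 (trans (fromℕ-+ 1 1) (trans (cong₂ _+_ 1≡0 1≡0) (+-identityˡ 0#)))

  x+x≡2*x : ∀ x → x + x ≡ fromℕ 2 * x
  x+x≡2*x x = begin
    x + x              ≡⟨ cong₂ _+_ (*-identityˡ x) (*-identityˡ x) ⟨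
    1# * x + 1# * x    ≡⟨ distribʳ x 1# 1# ⟨
    (1# + 1#) * x      ≡⟨ cong (_* x) (fromℕ-+ 1 1) ⟨
    fromℕ 2 * x        ∎

  x≡-x⇒x≡0 : ∀ {x} → x ≡ - x → x ≡ 0#
  x≡-x⇒x≡0 {x} x≡-x with x*y≡0⇒x≡0∨y≡0 (fromℕ 2) x
                            (trans (sym (x+x≡2*x x)) (trans (cong (λ y → x + y) x≡-x) (-‿inverseʳ x)))
  ... | inj₁ 2≡0 = contradiction 2≡0 2≢0
  ... | inj₂ x≡0 = x≡0

  -- The quadratic character and its behaviour under negation.

  -- The graph of `η` with witnesses: a case split yields a square root or a proof that none exists.
  -- `nonsquare` excludes `0#`, since `0#` is its own square.
  data QuadraticCharacter (x : 𝔽) : ℤ → Set where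
    zero      : x ≡ 0# → QuadraticCharacter x 0ℤ
    square    : ∀ s → s * s ≡ x → x ≢ 0# → QuadraticCharacter x 1ℤ
    nonsquare : (∀ s → s * s ≢ x) → QuadraticCharacter x -1ℤ

  η-graph : ∀ x → QuadraticCharacter x (η x)
  η-graph x with x ≟ 0# | any? (λ s → s * s ≟ x)
  ... | yes x≡0 | _            = zero x≡0
  ... | no  x≢0 | yes (s , eq) = square s eq x≢0
  ... | no  _   | no  ∄s       = nonsquare (λ s eq → ∄s (s , eq))

  -- The three constructors exclude one another. Together with `η-graph` this evaluates `η` at a
  -- point from any witness.
  η-unique : ∀ {x u v} → QuadraticCharacter x u → QuadraticCharacter x v → u ≡ v
  η-unique (zero _)           (zero _)           = refl
  η-unique (zero x≡0)         (square _ _ x≢0)   = contradiction x≡0 x≢0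
  η-unique (zero x≡0)         (nonsquare ∄s)     = contradiction (trans (zeroˡ 0#) (sym x≡0)) (∄s 0#)
  η-unique (square _ _ x≢0)   (zero x≡0)         = contradiction x≡0 x≢0
  η-unique (square _ _ _)     (square _ _ _)     = refl
  η-unique (square s eq _)    (nonsquare ∄s)     = contradiction eq (∄s s)
  η-unique (nonsquare ∄s)     (zero x≡0)         = contradiction (trans (zeroˡ 0#) (sym x≡0)) (∄s 0#)
  η-unique (nonsquare ∄s)     (square s eq _)    = contradiction eq (∄s s)
  η-unique (nonsquare _)      (nonsquare _)      = refl

  module _ (-1-nonsquare : ∀ s → s * s ≢ - 1#) where

    -- For nonzero `y` the quotient `x / y` would be a square root of `- 1#`.
    x*x≡-y*y⇒y≡0 : ∀ {x y} → x * x ≡ - (y * y) → y ≡ 0#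
    x*x≡-y*y⇒y≡0 {x} {y} x²≡-y² with y ≟ 0#
    ... | yes y≡0 = y≡0
    ... | no  y≢0 = contradiction x/y-root (-1-nonsquare (x / y))
      where
      x/y-root : (x / y) * (x / y) ≡ - 1#
      x/y-root = begin
        (x / y) * (x / y)                 ≡⟨ xy*xy≈xx*yy x (y ⁻¹) ⟩
        (x * x) * (y ⁻¹ * y ⁻¹)           ≡⟨ cong (_* (y ⁻¹ * y ⁻¹)) x²≡-y² ⟩
        - (y * y) * (y ⁻¹ * y ⁻¹)         ≡⟨ -‿distribˡ-* (y * y) (y ⁻¹ * y ⁻¹) ⟨
        - ((y * y) * (y ⁻¹ * y ⁻¹))       ≡⟨ cong (λ u → - u) (xy*xy≈xx*yy y (y ⁻¹)) ⟨
        - ((y * y ⁻¹) * (y * y ⁻¹))       ≡⟨ cong (λ u → - (u * u)) (*-inverseʳ y≢0) ⟩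
        - (1# * 1#)                       ≡⟨ cong (λ u → - u) (*-identityˡ 1#) ⟩
        - 1#                              ∎

    -- Both `x` and `y` must vanish. The equation is the form that injectivity of `signedSquare`
    -- asks for when the two signs differ.
    x*x≡-y*y⇒x≡y : ∀ {x y} → x * x ≡ - (y * y) → x ≡ y
    x*x≡-y*y⇒x≡y {x} {y} x²≡-y² = trans (x*x≡0⇒x≡0 {x} x²≡0) (sym y≡0)
      where
      y≡0 : y ≡ 0#
      y≡0 = x*x≡-y*y⇒y≡0 {x} x²≡-y²

      x²≡0 : x * x ≡ 0#
      x²≡0 = trans x²≡-y² (trans (cong (λ u → - (u * u)) y≡0) (trans (cong (λ u → - u) (zeroˡ 0#)) -0#≈0#))

    -- Choosing the sign of ± x² by which of x and − x has the smaller
    -- representative makes the map injective, hence onto: every y is ± a square.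
    signedSquare : 𝔽 → 𝔽
    signedSquare x with toℕ x ℕ.≤? toℕ (- x)
    ... | yes _ = x * x
    ... | no  _ = - (x * x)

    signedSquare-injective : Injective _≡_ _≡_ signedSquare
    signedSquare-injective {x} {y} eq
      with toℕ x ℕ.≤? toℕ (- x) | toℕ y ℕ.≤? toℕ (- y)
    ... | yes _   | no  _   = x*x≡-y*y⇒x≡y eq
    ... | no  _   | yes _   = sym (x*x≡-y*y⇒x≡y (sym eq))
    ... | yes x≤ | yes y≤ with x*x≡y*y⇒x≡±y eq
    ...   | inj₁ x≡y  = x≡y
    -- Here `x` is `- y`, and each of the two has a representative at most that of the other, so
    -- they coincide.
    ...   | inj₂ refl = toℕ-injective (ℕ.≤-antisym
                          (ℕ.≤-trans x≤ (ℕ.≤-reflexive (cong toℕ (-‿involutive y)))) y≤)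
    signedSquare-injective {x} {y} eq
        | no  x≰ | no  y≰ with x*x≡y*y⇒x≡±y (-‿injective eq)
    ...   | inj₁ x≡y  = x≡y
    -- Here `x` is `- y`, and the comparison cannot fail for both `y` and `- y`.
    ...   | inj₂ refl = contradiction
                          (ℕ.≤-trans (ℕ.≰⇒≥ y≰) (ℕ.≤-reflexive (cong toℕ (sym (-‿involutive y))))) x≰

    -- This takes the place of the fact that the nonzero squares have index 2 in the multiplicative
    -- group.
    ±square : ∀ y → ∃ λ s → s * s ≡ y ⊎ - (s * s) ≡ y
    ±square y with injective⇒surjective signedSquare-injective y
    ... | s , eq with toℕ s ℕ.≤? toℕ (- s)
    ...   | yes _ = s , inj₁ eq
    ...   | no  _ = s , inj₂ eq

  -‿square : ∀ {i s x} → i * i ≡ - 1# → s * s ≡ x → (i * s) * (i * s) ≡ - x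
  -‿square {i} {s} {x} i² s² = trans (xy*xy≈xx*yy i s) (trans (cong₂ _*_ i² s²) (-1*x≈-x x))

  -- If `i` is a root of `- 1#`, multiplication by `i` carries roots of `x` to roots of `- x` and
  -- back. If there is no such `i`, then `x` and `- x` cannot both be nonzero squares, and `±square`
  -- shows that at least one of them is a square.
  η-neg : ∀ x → η (- x) ≡ η (- 1#) ℤ.* η x
  η-neg x with η (- 1#) | η-graph (- 1#) | η x | η-graph x
  ... | _ | zero -1≡0     | _ | _                = contradiction (-x≡0⇒x≡0 -1≡0) 1≢0
  ... | e | _             | _ | zero x≡0         =
    trans (η-unique (η-graph (- x)) (zero (trans (cong (λ u → - u) x≡0) -0#≈0#))) (sym (ℤ.*-zeroʳ e))
  ... | _ | square i i² _ | _ | square s s² x≢0  =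
    η-unique (η-graph (- x)) (square (i * s) (-‿square {i} {s} i² s²) (x≢0 ∘ -x≡0⇒x≡0))
  ... | _ | square i i² _ | _ | nonsquare ∄s     =
    η-unique (η-graph (- x)) (nonsquare λ t t² → ∄s (i * t) (trans (-‿square {i} {t} i² t²) (-‿involutive x)))
  ... | _ | nonsquare ∄i  | _ | square s s² x≢0  =
    η-unique (η-graph (- x)) (nonsquare λ t t² →
      let s≡0 = x*x≡-y*y⇒y≡0 ∄i {t} {s} (trans t² (cong (λ u → - u) (sym s²)))
      in x≢0 (trans (sym s²) (trans (cong (λ u → u * u) s≡0) (zeroˡ 0#))))
  ... | _ | nonsquare ∄i  | _ | nonsquare ∄s with ±square ∄i x
  ...   | s , inj₁ s²  = contradiction s² (∄s s)
  ...   | s , inj₂ -s² =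
    η-unique (η-graph (- x)) (square s (-‿injective (trans -s² (sym (-‿involutive x))))
      (λ -x≡0 → ∄s 0# (trans (zeroˡ 0#) (sym (-x≡0⇒x≡0 -x≡0)))))

  -- Counting the roots of a monic quadratic.

  shift-root : ∀ {β h s} → β + h ≡ s → β ≡ s - h
  shift-root {β} {h} refl = sym (trans (+-assoc β h (- h)) (trans (cong (λ u → β + u) (-‿inverseʳ h)) (+-identityʳ β)))

  unshift-root : ∀ s h → s - h + h ≡ s
  unshift-root s h = trans (+-assoc s (- h) h) (trans (cong (λ u → s + u) (-‿inverseˡ h)) (+-identityʳ s))

  -- Each case of the character supplies the full list of solutions: a single one for zero, two
  -- shifted opposite roots for a nonzero square, none for a nonsquare.
  length-square-roots : ∀ h x → + length (filter (λ β → (β + h) * (β + h) ≟ x) (allFin p)) ≡ 1ℤ ℤ.+ η x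
  length-square-roots h x with η x | η-graph x
  ... | _ | zero refl = cong +_ (length-filter-allFin (λ β → (β + h) * (β + h) ≟ x) {xs = [ 0# - h ]} (All.[] ∷ []) λ β →
    mk⇔ (λ eq → here (shift-root (x*x≡0⇒x≡0 {β + h} eq)))
        λ { (here refl) → trans (cong (λ u → u * u) (unshift-root 0# h)) (zeroˡ 0#) })
  ... | _ | square s s² x≢0 = cong +_ (length-filter-allFin (λ β → (β + h) * (β + h) ≟ x) {xs = s - h ∷ - s - h ∷ []}
    ((s-h≢-s-h All.∷ All.[]) ∷ All.[] ∷ []) λ β →
    mk⇔ (λ eq → [ here ∘ shift-root , there ∘ here ∘ shift-root ]′ (x*x≡y*y⇒x≡±y {β + h} {s} (trans eq (sym s²))))
        λ { (here refl)         → trans (cong (λ u → u * u) (unshift-root s h)) s²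
          ; (there (here refl)) → trans (cong (λ u → u * u) (unshift-root (- s) h)) (trans (-x*-x≈x*x s) s²) })
    where
    -- The two listed solutions differ because `s` equals `- s` only for zero in odd characteristic.
    s-h≢-s-h : s - h ≢ - s - h
    s-h≢-s-h eq = x≢0 (trans (sym s²) (trans (cong (λ u → u * u) s≡0) (zeroˡ 0#)))
      where
      s≡0 : s ≡ 0#
      s≡0 = x≡-x⇒x≡0 (trans (sym (unshift-root s h)) (trans (cong (_+ h) eq) (unshift-root (- s) h)))
  ... | _ | nonsquare ∄s = cong (λ xs → + length xs)
    (filter-none (λ β → (β + h) * (β + h) ≟ x) (All.universal (λ β → ∄s (β + h)) (allFin p)))

  half+half : ∀ x → x / fromℕ 2 + x / fromℕ 2 ≡ x
  half+half x = begin
    x / fromℕ 2 + x / fromℕ 2             ≡⟨ x+x≡2*x (x / fromℕ 2) ⟩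
    fromℕ 2 * (x / fromℕ 2)               ≡⟨ *-comm (fromℕ 2) (x / fromℕ 2) ⟩
    x * fromℕ 2 ⁻¹ * fromℕ 2              ≡⟨ *-assoc x (fromℕ 2 ⁻¹) (fromℕ 2) ⟩
    x * (fromℕ 2 ⁻¹ * fromℕ 2)            ≡⟨ cong (λ u → x * u) (trans (*-comm (fromℕ 2 ⁻¹) (fromℕ 2)) (*-inverseʳ 2≢0)) ⟩
    x * 1#                                ≡⟨ *-identityʳ x ⟩
    x                                     ∎

  4≢0 : fromℕ 4 ≢ 0#
  4≢0 4≡0 = 2≢0 (x*x≡0⇒x≡0 {fromℕ 2} (trans (sym (fromℕ-* 2 2)) 4≡0))

  [x+x]²/4≡x² : ∀ x → ((x + x) * (x + x)) / fromℕ 4 ≡ x * x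
  [x+x]²/4≡x² x = begin
    (x + x) * (x + x) / fromℕ 4                          ≡⟨ cong (λ u → u * u / fromℕ 4) (x+x≡2*x x) ⟩
    (fromℕ 2 * x) * (fromℕ 2 * x) / fromℕ 4              ≡⟨ cong (_/ fromℕ 4) (xy*xy≈xx*yy (fromℕ 2) x) ⟩
    (fromℕ 2 * fromℕ 2) * (x * x) / fromℕ 4              ≡⟨ cong (λ u → u * (x * x) / fromℕ 4) (fromℕ-* 2 2) ⟨
    fromℕ 4 * (x * x) * fromℕ 4 ⁻¹                       ≡⟨ cong (_* fromℕ 4 ⁻¹) (*-comm (fromℕ 4) (x * x)) ⟩
    x * x * fromℕ 4 * fromℕ 4 ⁻¹                         ≡⟨ *-assoc (x * x) (fromℕ 4) (fromℕ 4 ⁻¹) ⟩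
    x * x * (fromℕ 4 * fromℕ 4 ⁻¹)                       ≡⟨ cong (λ u → x * x * u) (*-inverseʳ 4≢0) ⟩
    x * x * 1#                                           ≡⟨ *-identityʳ (x * x) ⟩
    x * x                                                ∎

  length-quadratic-roots : ∀ b c →
    + length (filter (λ β → β * β + b * β + c ≟ 0#) (allFin p)) ≡ 1ℤ ℤ.+ η (- 1#) ℤ.* η (c - (b * b) / fromℕ 4)
  length-quadratic-roots b c = begin
    + length (filter (λ β → β * β + b * β + c ≟ 0#) (allFin p))
      ≡⟨ cong (λ xs → + length xs) (filter-≐ (λ β → β * β + b * β + c ≟ 0#) (λ β → (β + h) * (β + h) ≟ - D) (root⇒ , root⇐) (allFin p)) ⟩
    + length (filter (λ β → (β + h) * (β + h) ≟ - D) (allFin p))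
      ≡⟨ length-square-roots h (- D) ⟩
    1ℤ ℤ.+ η (- D)
      ≡⟨ cong (λ u → 1ℤ ℤ.+ u) (η-neg D) ⟩
    1ℤ ℤ.+ η (- 1#) ℤ.* η D ∎
    where
    h D : 𝔽
    h = b / fromℕ 2
    D = c - (b * b) / fromℕ 4

    b²/4≡h² : (b * b) / fromℕ 4 ≡ h * h
    -- With `b` written as `h + h`, the numerator carries a factor 4 that cancels.
    b²/4≡h² = trans (cong (λ u → u * u / fromℕ 4) (sym (half+half b))) ([x+x]²/4≡x² h)

    completed : ∀ β → β * β + b * β + c ≡ (β + h) * (β + h) + D
    completed β = begin
      β * β + b * β + c                     ≡⟨ cong (λ u → β * β + u * β + c) (half+half b) ⟨
      β * β + (h + h) * β + c               ≡⟨ complete-square β h c ⟩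
      (β + h) * (β + h) + (c - h * h)       ≡⟨ cong (λ u → (β + h) * (β + h) + (c - u)) b²/4≡h² ⟨
      (β + h) * (β + h) + D                 ∎

    root⇒ : ∀ {β} → β * β + b * β + c ≡ 0# → (β + h) * (β + h) ≡ - D
    root⇒ {β} eq = x+y≡0⇒x≡-y (trans (sym (completed β)) eq)

    root⇐ : ∀ {β} → (β + h) * (β + h) ≡ - D → β * β + b * β + c ≡ 0#
    root⇐ {β} eq = trans (completed β) (trans (cong (_+ D) eq) (-‿inverseˡ D))

-- Evaluating the polynomials in several variables.

module _ (p : ℕ) .{{_ : NonZero p}} where
  open PrimeField p
  open PrimeFieldProperties p
  open ≡-Reasoning

  id-homo : PreservesOps 𝔽-ring commutativeRing (λ x → x)
  id-homo = record { 0#-homo = refl ; +-homo = λ _ _ → refl ; *-homo = λ _ _ → refl }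

  eval-homo : ∀ x → PreservesOps 𝔽[T]-ring commutativeRing (λ f → eval f x)
  eval-homo = eval₂-homo id-homo

  evalXZ-homo : ∀ x z → PreservesOps 𝔽[X,Z]-ring commutativeRing (λ f → evalXZ f x z)
  evalXZ-homo x = eval₂-homo (eval-homo x)

  evalXYZ-homo : ∀ x y z → PreservesOps 𝔽[X,Y,Z]-ring commutativeRing (λ f → evalXYZ f x y z)
  evalXYZ-homo x y z = eval₂-homo (evalXZ-homo x z) y

  -- This reconciles two readings of P(0,γ): the hypothesis on `r` specialises X first, whereas
  -- `N₀′` and `S` evaluate both variables at once.
  eval-specialiseX : ∀ x P z → eval (specialiseX x P) z ≡ evalXZ P x z
  eval-specialiseX x []      z = refl
  eval-specialiseX x (f ∷ P) z = cong (λ u → eval f x + z * u) (eval-specialiseX x P z)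

  -- A one-entry list evaluates to its entry plus a multiple of `0#`, so each use strips one layer
  -- of constants.
  +-*-zeroʳ : ∀ x y → x + y * 0# ≡ x
  +-*-zeroʳ x y = trans (cong (λ u → x + u) (zeroʳ y)) (+-identityʳ x)

  evalXYZ-X : ∀ x y z → evalXYZ X x y z ≡ x
  evalXYZ-X x y z = begin
    (0# + x * (1# + x * 0#)) + z * 0# + y * 0#     ≡⟨ trans (+-*-zeroʳ _ y) (+-*-zeroʳ _ z) ⟩
    0# + x * (1# + x * 0#)                         ≡⟨ +-identityˡ _ ⟩
    x * (1# + x * 0#)                              ≡⟨ cong (λ u → x * u) (+-*-zeroʳ 1# x) ⟩
    x * 1#                                         ≡⟨ *-identityʳ x ⟩
    x                                              ∎

  evalXYZ-Y : ∀ x y z → evalXYZ Y x y z ≡ y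
  evalXYZ-Y x y z = begin
    0# + y * ((1# + x * 0#) + z * 0# + y * 0#)     ≡⟨ +-identityˡ _ ⟩
    y * ((1# + x * 0#) + z * 0# + y * 0#)          ≡⟨ cong (λ u → y * u) (trans (+-*-zeroʳ _ y) (trans (+-*-zeroʳ _ z) (+-*-zeroʳ 1# x))) ⟩
    y * 1#                                         ≡⟨ *-identityʳ y ⟩
    y                                              ∎

  evalXZ-const : ∀ f x z → evalXZ (map (Poly.const 𝔽-ring) f) x z ≡ eval f z
  evalXZ-const []      x z = refl
  evalXZ-const (a ∷ f) x z = cong₂ (λ u v → u + z * v) (+-*-zeroʳ a x) (evalXZ-const f x z)

  evalXYZ-inZ : ∀ f x y z → evalXYZ (inZ f) x y z ≡ eval f z
  evalXYZ-inZ f x y z = trans (+-*-zeroʳ _ y) (evalXZ-const f x z)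

  -- Evaluation is a homomorphism, so `Q` is evaluated summand by summand. The product `X ⊗ Q₁` is
  -- never expanded: its first factor evaluates to `0#`.
  evalXYZ-Q : ∀ Q₁ b c β γ →
    evalXYZ (X ⊗ Q₁ ⊕ Y ⊗ Y ⊕ inZ b ⊗ Y ⊕ inZ c) 0# β γ ≡ β * β + eval b γ * β + eval c γ
  evalXYZ-Q Q₁ b c β γ = begin
    ev (X ⊗ Q₁ ⊕ Y ⊗ Y ⊕ inZ b ⊗ Y ⊕ inZ c)
      ≡⟨ +-homo (X ⊗ Q₁ ⊕ Y ⊗ Y ⊕ inZ b ⊗ Y) (inZ c) ⟩
    ev (X ⊗ Q₁ ⊕ Y ⊗ Y ⊕ inZ b ⊗ Y) + ev (inZ c)
      ≡⟨ cong (_+ ev (inZ c)) (+-homo (X ⊗ Q₁ ⊕ Y ⊗ Y) (inZ b ⊗ Y)) ⟩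
    ev (X ⊗ Q₁ ⊕ Y ⊗ Y) + ev (inZ b ⊗ Y) + ev (inZ c)
      ≡⟨ cong (λ u → u + ev (inZ b ⊗ Y) + ev (inZ c)) (+-homo (X ⊗ Q₁) (Y ⊗ Y)) ⟩
    ev (X ⊗ Q₁) + ev (Y ⊗ Y) + ev (inZ b ⊗ Y) + ev (inZ c)
      ≡⟨ cong₂ _+_ (cong₂ _+_ (cong₂ _+_ evXQ₁ (evProduct Y Y evY evY)) (evProduct (inZ b) Y (evZ b) evY)) (evZ c) ⟩
    0# + β * β + eval b γ * β + eval c γ
      ≡⟨ cong (λ u → u + eval b γ * β + eval c γ) (+-identityˡ (β * β)) ⟩
    β * β + eval b γ * β + eval c γ ∎
    where
    open PreservesOps (evalXYZ-homo 0# β γ)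

    ev : 𝔽[X,Y,Z] → 𝔽
    ev f = evalXYZ f 0# β γ

    evProduct : ∀ f g {u v} → ev f ≡ u → ev g ≡ v → ev (f ⊗ g) ≡ u * v
    evProduct f g ef eg = trans (*-homo f g) (cong₂ _*_ ef eg)

    evY : ev Y ≡ β
    evY = evalXYZ-Y 0# β γ

    evZ : ∀ f → ev (inZ f) ≡ eval f γ
    evZ f = evalXYZ-inZ f 0# β γ

    evXQ₁ : ev (X ⊗ Q₁) ≡ 0#
    evXQ₁ = trans (evProduct X Q₁ (evalXYZ-X 0# β γ) refl) (zeroˡ (ev Q₁))

-- Summation over the roots of P(0,Z).

theorem4p36 :
  (p : ℕ) .{{_ : NonZero p}} → Prime p → ¬ (2 ∣ p) →
  let open PrimeField p in
  (P : 𝔽[X,Z]) → MonicZ P → DegZ≥ 2 P →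
  (r : ℕ) → length (roots (specialiseX 0# P)) ≡ r →
  (Q₁ : 𝔽[X,Y,Z]) → DegY< 2 Q₁ →
  (b c : 𝔽[Z]) →
  let Q : 𝔽[X,Y,Z]
      Q = X ⊗ Q₁ ⊕ Y ⊗ Y ⊕ inZ b ⊗ Y ⊕ inZ c
      D : 𝔽 → 𝔽
      D γ = eval c γ - (eval b γ * eval b γ) / fromℕ 4
      N₀′ : ℕ
      N₀′ = length (filter (λ (β , γ) → (evalXZ P 0# γ ≟ 0#) ×-dec (evalXYZ Q 0# β γ ≟ 0#)) (cartesianProduct (allFin p) (allFin p)))
      S : ℤ
      S = sumℤ (map (λ γ → η (D γ)) (filter (λ γ → evalXZ P 0# γ ≟ 0#) (allFin p)))
  in
  + N₀′ ≡ + r ℤ.+ η (- 1#) ℤ.* S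
theorem4p36 p p-prime p-odd P _ _ r #roots≡r Q₁ _ b c = begin
  + length (filter zero? (cartesianProduct (allFin p) (allFin p)))
    -- The pairs are grouped by γ, and `N γ` counts the β above it.
    ≡⟨ cong +_ (length-filter-cartesianProduct zero? (allFin p) (allFin p)) ⟩
  + List.sum (map N (allFin p))
    ≡⟨ sum-over-filter P-root? (λ γ → η (D γ)) (η (- 1#)) N N-root N-nonroot (allFin p) ⟩
  + length (filter P-root? (allFin p)) ℤ.+ η (- 1#) ℤ.* S
    ≡⟨ cong (λ k → + k ℤ.+ η (- 1#) ℤ.* S) #P-roots≡r ⟩
  + r ℤ.+ η (- 1#) ℤ.* S ∎
  where
  open PrimeField p
  open OddPrimeFieldProperties p p-prime p-odd
  open ≡-Reasoning

  Q : 𝔽[X,Y,Z]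
  Q = X ⊗ Q₁ ⊕ Y ⊗ Y ⊕ inZ b ⊗ Y ⊕ inZ c

  D : 𝔽 → 𝔽
  D γ = eval c γ - (eval b γ * eval b γ) / fromℕ 4

  P-root? : Decidable (λ γ → evalXZ P 0# γ ≡ 0#)
  P-root? γ = evalXZ P 0# γ ≟ 0#

  zero? : Decidable (λ ((β , γ) : 𝔽 × 𝔽) → evalXZ P 0# γ ≡ 0# × evalXYZ Q 0# β γ ≡ 0#)
  zero? (β , γ) = P-root? γ ×-dec (evalXYZ Q 0# β γ ≟ 0#)

  S : ℤ
  S = sumℤ (map (λ γ → η (D γ)) (filter P-root? (allFin p)))

  N : 𝔽 → ℕ
  N γ = length (filter (λ β → zero? (β , γ)) (allFin p))

  N-root : ∀ γ → evalXZ P 0# γ ≡ 0# → + N γ ≡ 1ℤ ℤ.+ η (- 1#) ℤ.* η (D γ)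
  N-root γ Pγ≡0 = trans
    -- Over a root γ the condition on `P` holds for every β, which leaves only the quadratic in β.
    (cong (λ xs → + length xs) (filter-≐ (λ β → zero? (β , γ)) (λ β → β * β + eval b γ * β + eval c γ ≟ 0#)
      ( (λ {β} (_ , Q≡0) → trans (sym (evalXYZ-Q p Q₁ b c β γ)) Q≡0)
      , (λ {β} eq → Pγ≡0 , trans (evalXYZ-Q p Q₁ b c β γ) eq)) (allFin p)))
    (length-quadratic-roots (eval b γ) (eval c γ))

  N-nonroot : ∀ γ → evalXZ P 0# γ ≢ 0# → N γ ≡ 0
  N-nonroot γ Pγ≢0 = cong length (filter-none (λ β → zero? (β , γ)) (All.universal (λ _ → Pγ≢0 ∘ proj₁) (allFin p)))

  #P-roots≡r : length (filter P-root? (allFin p)) ≡ r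
  #P-roots≡r = trans (cong length (filter-≐ P-root? (λ γ → eval (specialiseX 0# P) γ ≟ 0#)
    ( (λ {γ} → trans (eval-specialiseX p 0# P γ))
    , (λ {γ} → trans (sym (eval-specialiseX p 0# P γ)))) (allFin p))) #roots≡r
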